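{- Let $(G,R)$ be a finite rooted graph without sinks such that $t^{ -1}(R)=\emptyset$, $|o^{ -1}(R)|>2$, and the graph $G\setminus\{R\}$ is strongly connected and non-redundant. If the unfolding tree $\mathcal{T}(G,R)$ is cocompact, then $(G,R)$ admits an actual labelling.
   Context: A graph $G=(VG,EG,o,t)$ is a directed multigraph (loops and multiple edges allowed). A sink is a vertex $v$ with $o^{ -1}(v)=\emptyset$. A path is an empty path $\varepsilon_v$ or a sequence $e_1\cdots e_n$ of edges with $t(e_i)=o(e_{i+1})$; $O(p),T(p)$ are its origin and terminus. A rooted graph $(G,R)$ is a graph with a vertex $R$ from which every vertex is reachable. $G\setminus\{R\}$ is the subgraph obtained by deleting $R$ and all edges incident to it; it is strongly connected if any vertex can be reached from any other by a directed path. A rooted tree is a graph with a vertex $R$ such that every vertex has a unique path from $R$. The unfolding tree $\mathcal{T}(G,R)$ has vertices the paths $p$ with $O(p)=R$ and edges $(p,pe)$ from $p$ to $pe$ for each edge $e$ with $o(e)=T(p)$. For a rooted tree $\mathcal{T}$ with root $R$ and vertex $v$, $\mathcal{T}^v$ is obtained by reversing the edges on the path from $R$ to $v$. $\cong$ is isomorphism of directed graphs. A rooted tree is cocompact if there are a finite set $F$ and $l:V\mathcal{T}\to F$ with $l(v)=l(w)\Rightarrow\mathcal{T}^v\cong\mathcal{T}^w$. Non-edge-collapsing (n.e.c.) relation on a graph $H$: an equivalence relation $\sim$ on vertices and on edges, compatible with $o$ and $t$, such that for all vertices $v\sim w$ there are bijections $\pi_{v,w}:o^{ -1}(v)\to o^{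 -1}(w)$ with $e\sim f\iff o(e)\sim o(f)$ and $\pi_{o(e),o(f)}(e)=f$. A graph $H$ is non-redundant if the only n.e.c. relation on $H$ is equality. Multisets over $X$ have positive integer multiplicities; union adds multiplicities; $M\setminus\{x\}$ removes one copy. $t_m(o^{ -1}(v))$ is the multiset of termini of edges leaving $v$ counted with the number of edges; $l(t_m(o^{ -1}(v)))$ its multiset of labels. Actual labelling of $(G,R)$ with $t^{ -1}(R)=\emptyset$: a finite set $X$, maps $l:VG\to X$, $l_p:VG\setminus\{R\}\to X$, and multisets $M_x$ ($x\in X$) such that for all $v\neq R$: (1) $l_p(v)\in M_{l(v)}$; (2) $l(t_m(o^{ -1}(v)))=M_{l(v)}\setminus\{l_p(v)\}$; (3) $l(o(e))=l_p(v)$ for all edges $e$ with $t(e)=v$; and (4) $l(t_m(o^{ -1}(R)))=M_{l(R)}$. -}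

module Defs where

open import Data.Nat using (ℕ; _∸_; _<_; _≤_)
open import Data.Fin using (Fin)
open import Data.Fin.Properties using (_≟_)
open import Data.List using (List; []; _∷_; _++_; [_]; length; filter; allFin)
open import Data.Bool using (Bool; true; false; _∧_; if_then_else_)
open import Data.Product using (Σ; Σ-syntax; ∃; _×_; _,_; proj₁; proj₂)
open import Relation.Nullary using (¬_; does)
open import Relation.Nullary.Decidable using (False; _×-dec_)
open import Relation.Binary using (IsEquivalence; DecidableEquality)
open import Relation.Binary.PropositionalEquality using (_≡_; refl)
open import Function.Bundles using (_↔_; Inverse; _⇔_)

record Graph : Set₁ where
  field
    V : Set
    E : Set
    o : E → V
    t : E → V

open Graph public

data Path (G : Graph) (v : V G) : V G → Set where
  ε     : Path G v v
  _▷_⟨_⟩ : ∀ {w} → Path G v w → (e : E G) → o G e ≡ w → Path G v (t G e)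

edgeList : ∀ {G v w} → Path G v w → List (E G)
edgeList ε = []
edgeList (p ▷ e ⟨ _ ⟩) = edgeList p ++ [ e ]

record _≅_ (G H : Graph) : Set where
  field
    isoV  : V G ↔ V H
    isoE  : E G ↔ E H
    o-hom : ∀ e → o H (Inverse.to isoE e) ≡ Inverse.to isoV (o G e)
    t-hom : ∀ e → t H (Inverse.to isoE e) ≡ Inverse.to isoV (t G e)

finGraph : ∀ {n m} → (Fin m → Fin n) → (Fin m → Fin n) → Graph
finGraph {n} {m} o t = record { V = Fin n ; E = Fin m ; o = o ; t = t }

outDegree : ∀ {n m} → (Fin m → Fin n) → Fin n → ℕ
outDegree {n} {m} o v = length (filter (λ e → o e ≟ v) (allFin m))

Rooted : (G : Graph) → V G → Set
Rooted G R = ∀ v → Path G R v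

NoSinks : Graph → Set
NoSinks G = ∀ v → ∃ λ e → o G e ≡ v

_∖[_,_] : (G : Graph) → V G → DecidableEquality (V G) → Graph
G ∖[ R , _≟V_ ] = record
  { V = Σ[ v ∈ V G ] False (v ≟V R)
  ; E = Σ[ e ∈ E G ] (False (o G e ≟V R) × False (t G e ≟V R))
  ; o = λ { (e , a , _) → (o G e , a) }
  ; t = λ { (e , _ , b) → (t G e , b) }
  }

StronglyConnected : Graph → Set
StronglyConnected H = ∀ v w → Path H v w

OutEdges : (H : Graph) → V H → Set
OutEdges H v = Σ[ e ∈ E H ] (o H e ≡ v)

record NEC (H : Graph) : Set₁ where
  field
    _∼ᵥ_     : V H → V H → Set
    _∼ₑ_     : E H → E H → Set
    ∼ᵥ-equiv : IsEquivalence _∼ᵥ_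
    ∼ₑ-equiv : IsEquivalence _∼ₑ_
    -- relations are subsets (proof-irrelevant)
    ∼ᵥ-prop  : ∀ {v w} (p q : v ∼ᵥ w) → p ≡ q
    ∼ₑ-prop  : ∀ {e f} (p q : e ∼ₑ f) → p ≡ q
    o-compat : ∀ {e f} → e ∼ₑ f → o H e ∼ᵥ o H f
    t-compat : ∀ {e f} → e ∼ₑ f → t H e ∼ᵥ t H f
    π        : ∀ {v w} → v ∼ᵥ w → OutEdges H v ↔ OutEdges H w
    π-spec   : ∀ e f → (e ∼ₑ f) ⇔
                 (Σ[ p ∈ o H e ∼ᵥ o H f ] (proj₁ (Inverse.to (π p) (e , refl)) ≡ f))

NonRedundant : Graph → Set₁
NonRedundant H = (r : NEC H) →
  (∀ v w → NEC._∼ᵥ_ r v w → v ≡ w) × (∀ e f → NEC._∼ₑ_ r e f → e ≡ f)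

Unfolding : (G : Graph) → V G → Graph
Unfolding G R = record
  { V = Σ[ v ∈ V G ] Path G R v
  ; E = Σ[ x ∈ Σ[ v ∈ V G ] Path G R v ] Σ[ e ∈ E G ] (o G e ≡ proj₁ x)
  ; o = λ { (x , _ , _) → x }
  ; t = λ { ((v , p) , e , eq) → (t G e , p ▷ e ⟨ eq ⟩) }
  }

isPrefix : ∀ {A : Set} → DecidableEquality A → List A → List A → Bool
isPrefix _≟A_ []       _        = true
isPrefix _≟A_ (x ∷ xs) []       = false
isPrefix _≟A_ (x ∷ xs) (y ∷ ys) = does (x ≟A y) ∧ isPrefix _≟A_ xs ys

reverseOn : (H : Graph) → (E H → Bool) → Graph
reverseOn H f = record
  { V = V H
  ; E = E H
  ; o = λ e → if f e then t H e else o H e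
  ; t = λ e → if f e then o H e else t H e
  }

-- In 𝒯(G,R), the path from the root ε_R to the vertex p consists of the
-- edges (q , qe) whose target qe is a (nonempty) prefix of p.
onRootPath : (G : Graph) (R : V G) → DecidableEquality (E G) →
             V (Unfolding G R) → E (Unfolding G R) → Bool
onRootPath G R _≟E_ q edge =
  isPrefix _≟E_ (edgeList (proj₂ (t (Unfolding G R) edge))) (edgeList (proj₂ q))

UnfoldingAt : (G : Graph) (R : V G) → DecidableEquality (E G) →
              V (Unfolding G R) → Graph
UnfoldingAt G R dE q = reverseOn (Unfolding G R) (onRootPath G R dE q)

Cocompact : (G : Graph) (R : V G) → DecidableEquality (E G) → Set
Cocompact G R dE =
  Σ[ k ∈ ℕ ] Σ[ l ∈ (V (Unfolding G R) → Fin k) ]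
    (∀ v w → l v ≡ l w → UnfoldingAt G R dE v ≅ UnfoldingAt G R dE w)

-- Actual labelling (finite graphs).  X = Fin k; a multiset over X is its
-- multiplicity function X → ℕ (elements are those of positive multiplicity).

δ : ∀ {k} → Fin k → Fin k → ℕ
δ x y = if does (x ≟ y) then 1 else 0

labelCount : ∀ {n m k} → (Fin m → Fin n) → (Fin m → Fin n) →
             (Fin n → Fin k) → Fin n → Fin k → ℕ
labelCount {n} {m} o t l v x =
  length (filter (λ e → (o e ≟ v) ×-dec (l (t e) ≟ x)) (allFin m))

record ActualLabelling {n m} (o t : Fin m → Fin n) (R : Fin n) : Set where
  field
    k  : ℕ
    l  : Fin n → Fin k
    lp : Fin n → Fin k          -- only its values on VG ∖ {R} matter
    M  : Fin k → (Fin k → ℕ)    -- M x y = multiplicity of y in M_x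
    cond1 : ∀ v → ¬ v ≡ R → 1 ≤ M (l v) (lp v)
    cond2 : ∀ v → ¬ v ≡ R → ∀ x → labelCount o t l v x ≡ M (l v) x ∸ δ x (lp v)
    cond3 : ∀ v → ¬ v ≡ R → ∀ e → t e ≡ v → l (o e) ≡ lp v
    cond4 : ∀ x → labelCount o t l R x ≡ M (l R) x

{-# OPTIONS --safe #-}

-- View the unfolding tree 𝒯 as an undirected tree.  An isomorphism
-- 𝒯^p ≅ 𝒯^q is an automorphism of it, and once p lies much deeper than q it
-- turns upside down the edges near the root on the path to p.  Since the
-- vertices of G ∖ R are determined by their unfoldings (non-redundancy),
-- cocompactness thus shows that what is seen from a vertex of 𝒯 through the
-- edge towards the root is again the unfolding of some vertex of G ∖ R.
-- This backward vertex depends only on the terminus v of the path: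
-- prolonging two paths to v by the same k edges makes the backward
-- unfoldings agree up to depth k, hence equal for large k, and backward
-- vertices can be recovered from those of a prolongation.  Writing β v for
-- it, β is an involution off R, and the multiset {β v} ∪ t_m(o⁻¹(v)) of the
-- types of all neighbours of v in 𝒯 is the label of v, with l_p = l ∘ β.
module Submission where

open import Defs
open import Data.Nat using (ℕ; zero; suc; _+_; _∸_; _*_; _≤_; _<_; z≤n; s≤s)
import Data.Nat.Properties as ℕ
open import Data.Fin using (Fin; zero; suc; toℕ)
open import Data.Fin.Properties using (_≟_; all?; any?; pigeonhole; ≤-totalOrder; ≤-decTotalOrder)
open import Data.Bool using (Bool; true; false; T; _∧_; if_then_else_)
open import Data.Bool.Properties using (T-irrelevant)
open import Data.List using (List; []; _∷_; _++_; [_]; length; filter; map; allFin; tabulate;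
  cartesianProduct)
import Data.List.Properties as List
open import Data.List.Membership.Propositional using (_∈_)
open import Data.List.Membership.Propositional.Properties
  using (∈-filter⁺; ∈-filter⁻; ∈-allFin; ∈-map⁺; ∈-map⁻; ∈-++⁺ʳ; ∈-++⁻; ∈-∃++; ∈-cartesianProduct⁺)
open import Data.List.Membership.Propositional.Properties.WithK using (unique∧set⇒bag)
open import Data.List.Relation.Binary.BagAndSetEquality using (∼bag⇒↭)
open import Data.List.Relation.Binary.Permutation.Propositional
  using (_↭_; prep; ↭-refl; ↭-sym; ↭-trans; ↭-reflexive; ↭⇒↭ₛ; module PermutationReasoning)
open import Data.List.Relation.Binary.Permutation.Propositional.Properties
  using (map⁺; drop-∷; shift; filter-↭; ↭-length; ++⁺ˡ; ∈-resp-↭)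
import Data.List.Relation.Binary.Permutation.Setoid.Properties as Permutationₛ
open import Data.List.Relation.Binary.Pointwise using (Pointwise-≡⇒≡)
import Data.List.Relation.Unary.All as All
open import Data.List.Relation.Unary.All.Properties using (¬All⇒Any¬)
open import Data.List.Relation.Unary.AllPairs using ([]; _∷_)
open import Data.List.Relation.Unary.Any using (here; there)
import Data.List.Relation.Unary.Any as Any
open import Data.List.Relation.Unary.Sorted.TotalOrder.Properties using (↗↭↗⇒≋)
open import Data.List.Relation.Unary.Unique.Propositional using (Unique)
import Data.List.Relation.Unary.Unique.Propositional.Properties as Unique
open import Data.Product using (∃; _×_; _,_; proj₁; proj₂)
open import Data.Sum using (_⊎_; inj₁; inj₂; [_,_]′)
open import Data.Unit using (⊤; tt)
open import Function using (_∘_)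
open import Function.Bundles using (_↔_; mk⇔; mk↔ₛ′; Inverse; _⇔_)
open import Relation.Nullary using (¬_; Dec; yes; no; does; contradiction)
open import Relation.Nullary.Decidable
  using (_×-dec_; _→-dec_; dec-true; dec-false; does-⇔; fromWitnessFalse)
open import Relation.Unary using (Decidable)
open import Relation.Binary using (DecidableEquality)
open import Relation.Binary.PropositionalEquality hiding ([_])

-- Counting and ranking in finite sets.

T⇒ : ∀ {A : Set} (a? : Dec A) → T (does a?) → A
T⇒ (yes a) _ = a

⇒T : ∀ {A : Set} (a? : Dec A) → A → T (does a?)
⇒T (yes _) _ = tt
⇒T (no ¬a) a = ¬a a

indicator : Bool → ℕ
indicator true  = 1
indicator false = 0

count : ∀ {m} → (Fin m → Bool) → ℕ
count {zero}  f = 0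
count {suc m} f = indicator (f zero) + count (f ∘ suc)

-- By `rank<count`, `rank-injective` and `rank-surjective`, this numbers the true positions of `f`
-- by the naturals below `count f`. Equal counts thus give a canonical matching, the source of the
-- bijections in the n.e.c. relation.
rank : ∀ {m} → (Fin m → Bool) → Fin m → ℕ
rank f zero    = 0
rank f (suc i) = indicator (f zero) + rank (f ∘ suc) i

rank-cong : ∀ {m} {f g : Fin m → Bool} → (∀ i → f i ≡ g i) → ∀ i → rank f i ≡ rank g i
rank-cong f≗g zero    = refl
rank-cong f≗g (suc i) = cong₂ _+_ (cong indicator (f≗g zero)) (rank-cong (f≗g ∘ suc) i)

rank<count : ∀ {m} (f : Fin m → Bool) i → f i ≡ true → rank f i < count f
rank<count f zero    fi rewrite fi = s≤s z≤n
rank<count f (suc i) fi = ℕ.+-monoʳ-< (indicator (f zero)) (rank<count (f ∘ suc) i fi)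

rank-injective : ∀ {m} (f : Fin m → Bool) i j → f i ≡ true → f j ≡ true →
                 rank f i ≡ rank f j → i ≡ j
rank-injective f zero    zero    fi fj eq = refl
rank-injective f zero    (suc j) fi fj eq rewrite fi with () ← eq
rank-injective f (suc i) zero    fi fj eq rewrite fj with () ← eq
rank-injective f (suc i) (suc j) fi fj eq =
  cong suc (rank-injective (f ∘ suc) i j fi fj (ℕ.+-cancelˡ-≡ (indicator (f zero)) _ _ eq))

rank-surjective : ∀ {m} (f : Fin m → Bool) r → r < count f → ∃ λ i → f i ≡ true × rank f i ≡ r
rank-surjective {suc m} f r r< with f zero in eq
rank-surjective {suc m} f zero    r<       | true = zero , eq , refl
rank-surjective {suc m} f (suc r) (s≤s r<) | true
  with i , fi , ri ← rank-surjective (f ∘ suc) r r<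
  = suc i , fi , trans (cong (λ b → indicator b + rank (f ∘ suc) i) eq) (cong suc ri)
rank-surjective {suc m} f r       r<       | false
  with i , fi , ri ← rank-surjective (f ∘ suc) r r<
  = suc i , fi , trans (cong (λ b → indicator b + rank (f ∘ suc) i) eq) ri

# : ∀ {A : Set} {P : A → Set} → Decidable P → List A → ℕ
# P? xs = length (filter P? xs)

#-tabulate : ∀ {A : Set} {P : A → Set} (P? : Decidable P) {m} (g : Fin m → A) →
             # P? (tabulate g) ≡ count (does ∘ P? ∘ g)
#-tabulate P? {zero}  g = refl
#-tabulate P? {suc m} g with does (P? (g zero))
... | true  = cong suc (#-tabulate P? (g ∘ suc))
... | false = #-tabulate P? (g ∘ suc)

#-map-filter : ∀ {A B : Set} {P : A → Set} {Q : B → Set} (P? : Decidable P) (Q? : Decidable Q)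
               (f : A → B) xs →
               # Q? (map f (filter P? xs)) ≡ # (λ x → P? x ×-dec Q? (f x)) xs
#-map-filter P? Q? f []       = refl
#-map-filter P? Q? f (x ∷ xs) with does (P? x)
... | false = #-map-filter P? Q? f xs
... | true with does (Q? (f x))
...   | true  = cong suc (#-map-filter P? Q? f xs)
...   | false = #-map-filter P? Q? f xs

-- `go` keeps a list covering the elements that satisfy `P k`. If level `k` is not stable, filtering
-- by `P (suc k)` drops at least one entry, so the length of the list bounds the search.
descending-stabilises :
  ∀ {A : Set} (P : ℕ → A → Set) → (∀ k → Decidable (P k)) → (∀ k a → P (suc k) a → P k a) →
  (xs : List A) → (∀ a → a ∈ xs) → ∃ λ k → ∀ a → P k a → P (suc k) a
descending-stabilises P P? anti xs all∈ = go (length xs) 0 xs ℕ.≤-refl (λ a _ → all∈ a)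
  where
  go : ∀ fuel k xs → length xs ≤ fuel → (∀ a → P k a → a ∈ xs) → ∃ λ k → ∀ a → P k a → P (suc k) a
  go fuel k xs len covers with All.all? (λ a → P? k a →-dec P? (suc k) a) xs
  ... | yes stable = k , λ a pa → All.lookup stable (covers a pa) pa
  go zero    k [] len covers | no ¬stable = contradiction All.[] ¬stable
  go (suc fuel) k xs len covers | no ¬stable =
    go fuel (suc k) (filter (P? (suc k)) xs) (ℕ.≤-pred (ℕ.≤-trans shorter len))
       (λ a pa → ∈-filter⁺ (P? (suc k)) (covers a (anti k a pa)) pa)
    where
    shorter : length (filter (P? (suc k)) xs) < length xs
    shorter = List.filter-notAll (P? (suc k)) xs
      (Any.map (λ ¬imp p → ¬imp (λ _ → p))
        (¬All⇒Any¬ (λ a → P? k a →-dec P? (suc k) a) xs ¬stable))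

-- Partition refinement and the n.e.c. relation it induces.

module Refinement {n m} (o t : Fin m → Fin n) where

  outs : Fin n → List (Fin n)
  outs v = map t (filter (λ e → o e ≟ v) (allFin m))

  mutual
    -- Colour refinement: the unfoldings from `v` and `w` agree up to depth `k`. Each class is named
    -- by any of its members `u`, so no quotient is formed.
    _∼[_]_ : Fin n → ℕ → Fin n → Set
    v ∼[ zero ]  w = ⊤
    v ∼[ suc k ] w = v ∼[ k ] w × (∀ u → # (_∼[ k ]? u) (outs v) ≡ # (_∼[ k ]? u) (outs w))

    _∼[_]?_ : ∀ v k w → Dec (v ∼[ k ] w)
    v ∼[ zero ]?  w = yes tt
    v ∼[ suc k ]? w = (v ∼[ k ]? w) ×-dec all? (λ u → # (_∼[ k ]? u) (outs v) ℕ.≟ # (_∼[ k ]? u) (outs w))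

  ∼-refl : ∀ k {v} → v ∼[ k ] v
  ∼-refl zero    = tt
  ∼-refl (suc k) = ∼-refl k , λ _ → refl

  ∼-sym : ∀ k {v w} → v ∼[ k ] w → w ∼[ k ] v
  ∼-sym zero    _       = tt
  ∼-sym (suc k) (p , q) = ∼-sym k p , sym ∘ q

  ∼-trans : ∀ k {v w x} → v ∼[ k ] w → w ∼[ k ] x → v ∼[ k ] x
  ∼-trans zero    _       _         = tt
  ∼-trans (suc k) (p , q) (p′ , q′) = ∼-trans k p p′ , λ u → trans (q u) (q′ u)

  ∼-stabilises : ∃ λ k → ∀ {v w} → v ∼[ k ] w → v ∼[ suc k ] w
  ∼-stabilises
    with k , stable ← descending-stabilises (λ k (v , w) → v ∼[ k ] w) (λ k (v , w) → v ∼[ k ]? w)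
                        (λ _ _ → proj₁) (cartesianProduct (allFin n) (allFin n))
                        (λ (v , w) → ∈-cartesianProduct⁺ (∈-allFin v) (∈-allFin w))
    = k , stable _

  module _ (k : ℕ) (stable : ∀ {v w} → v ∼[ k ] w → v ∼[ suc k ] w)
           (R : Fin n) (t≢R : ∀ e → ¬ t e ≡ R) where

    private
      H : Graph
      H = finGraph o t ∖[ R , _≟_ ]

      sel : Fin n → Fin n → Fin m → Bool
      sel v u e = does (o e ≟ v) ∧ does (t e ∼[ k ]? u)

      sel-intro : ∀ {v u e} → o e ≡ v → t e ∼[ k ] u → sel v u e ≡ true
      sel-intro {v} {u} {e} p q rewrite dec-true (o e ≟ v) p | dec-true (t e ∼[ k ]? u) q = refl

      sel-elim : ∀ v u e → sel v u e ≡ true → o e ≡ v × t e ∼[ k ] u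
      sel-elim v u e eq with o e ≟ v | t e ∼[ k ]? u
      ... | yes p | yes q = p , q

      sel-cong : ∀ {v u u′} → u ∼[ k ] u′ → ∀ e → sel v u e ≡ sel v u′ e
      sel-cong {v} {u} {u′} p e = cong (does (o e ≟ v) ∧_)
        (does-⇔ (mk⇔ (λ q → ∼-trans k q p) (λ q → ∼-trans k q (∼-sym k p))) (t e ∼[ k ]? u) (t e ∼[ k ]? u′))

      count-sel : ∀ v u → # (_∼[ k ]? u) (outs v) ≡ count (sel v u)
      count-sel v u = trans (#-map-filter (λ e → o e ≟ v) (_∼[ k ]? u) t (allFin m))
                            (#-tabulate (λ e → (o e ≟ v) ×-dec (t e ∼[ k ]? u)) (λ e → e))

      -- Two edges correspond when they have the same position among the
      -- edges leaving their origin towards the class of their terminus.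
      position : Fin m → ℕ
      position e = rank (sel (o e) (t e)) e

      Corr : Fin m → Fin m → Set
      Corr e f = T (does (o e ∼[ k ]? o f)) × T (does (t e ∼[ k ]? t f)) × position e ≡ position f

      Corr-unique : ∀ {e f g} → Corr e f → Corr e g → o f ≡ o g → f ≡ g
      Corr-unique {e} {f} {g} (_ , tf , pf) (_ , tg , pg) of≡og =
        rank-injective (sel (o g) (t g)) f g
          (sel-intro of≡og f∼g) (sel-intro refl (∼-refl k))
          (trans (trans (sym (rank-cong (λ i → sel-cong f∼g i) f))
                        (cong (λ v → rank (sel v (t f)) f) (sym of≡og)))
                 (trans (sym pf) pg))
        where
        f∼g : t f ∼[ k ] t g
        f∼g = ∼-trans k (∼-sym k (T⇒ (t e ∼[ k ]? t f) tf)) (T⇒ (t e ∼[ k ]? t g) tg)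

      -- Stability makes the edges towards the class of `t e` equally numerous at `o e` and at `w`,
      -- so the position of `e` is also occupied at `w`.
      Corr-exists : ∀ e w → o e ∼[ k ] w → ∃ λ f → o f ≡ w × Corr e f
      Corr-exists e w oe∼w
        with f , sf , rf ← rank-surjective (sel w (t e)) (position e)
               (subst (position e <_)
                 (trans (sym (count-sel (o e) (t e))) (trans (proj₂ (stable oe∼w) (t e)) (count-sel w (t e))))
                 (rank<count (sel (o e) (t e)) e (sel-intro refl (∼-refl k))))
        with refl , tf ← sel-elim w (t e) f sf
        = f , refl , ⇒T (o e ∼[ k ]? o f) oe∼w , ⇒T (t e ∼[ k ]? t f) (∼-sym k tf) ,
          trans (sym rf) (rank-cong (λ i → sel-cong (∼-sym k tf) i) f)

      Corr-sym : ∀ {e f} → Corr e f → Corr f e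
      Corr-sym {e} {f} (p , q , r) =
        ⇒T (o f ∼[ k ]? o e) (∼-sym k (T⇒ (o e ∼[ k ]? o f) p)) ,
        ⇒T (t f ∼[ k ]? t e) (∼-sym k (T⇒ (t e ∼[ k ]? t f) q)) , sym r

      V-≡ : {v w : V H} → proj₁ v ≡ proj₁ w → v ≡ w
      V-≡ {v , a} {.v , b} refl = cong (v ,_) (T-irrelevant a b)

      E-≡ : {e f : E H} → proj₁ e ≡ proj₁ f → e ≡ f
      E-≡ {e , a , a′} {.e , b , b′} refl = cong₂ (λ x y → e , x , y) (T-irrelevant a b) (T-irrelevant a′ b′)

      Out-≡ : ∀ {v} {x y : OutEdges H v} → proj₁ (proj₁ x) ≡ proj₁ (proj₁ y) → x ≡ y
      Out-≡ {x = x , refl} {y , q} eq with refl ← E-≡ {x} {y} eq with refl ← q = refl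

      transport : ∀ {v w : V H} → T (does (proj₁ v ∼[ k ]? proj₁ w)) → OutEdges H v → OutEdges H w
      transport {v , _} {w , w≢R} v∼w ((e , _) , refl)
        with f , refl , _ ← Corr-exists e w (T⇒ (v ∼[ k ]? w) v∼w)
        -- As no edge ends in `R`, an edge lies in `H` as soon as its origin does.
        = (f , w≢R , fromWitnessFalse (t≢R f)) , V-≡ refl

      transport-Corr : ∀ {v w : V H} (p : T (does (proj₁ v ∼[ k ]? proj₁ w))) (x : OutEdges H v) →
                       Corr (proj₁ (proj₁ x)) (proj₁ (proj₁ (transport {v} {w} p x)))
      transport-Corr {v , _} {w , _} v∼w ((e , _) , refl)
        with f , refl , c ← Corr-exists e w (T⇒ (v ∼[ k ]? w) v∼w)
        = c

      ∼T-sym : ∀ {v w} → T (does (v ∼[ k ]? w)) → T (does (w ∼[ k ]? v))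
      ∼T-sym {v} {w} p = ⇒T (w ∼[ k ]? v) (∼-sym k (T⇒ (v ∼[ k ]? w) p))

      origin : ∀ {v : V H} (x : OutEdges H v) → o (proj₁ (proj₁ x)) ≡ proj₁ v
      origin (_ , refl) = refl

      -- Both `x` and its image under the round trip correspond to `transport p x` and leave `v`, so
      -- `Corr-unique` applies.
      transport-inverse : ∀ {v w : V H} (p : T (does (proj₁ v ∼[ k ]? proj₁ w)))
                          (q : T (does (proj₁ w ∼[ k ]? proj₁ v))) (x : OutEdges H v) →
                          transport {w} {v} q (transport {v} {w} p x) ≡ x
      transport-inverse {v} {w} p q x = Out-≡ (sym (Corr-unique
        {proj₁ (proj₁ (transport {v} {w} p x))}
        (Corr-sym (transport-Corr {v} {w} p x)) (transport-Corr {w} {v} q (transport {v} {w} p x))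
        (trans (origin x) (sym (origin (transport {w} {v} q (transport {v} {w} p x)))))))

    -- Similarity enters through `T (does _)` because the relations must be proof-irrelevant. In
    -- `π-spec`, `transport-Corr` gives one direction and `Corr-unique` the other.
    ∼-NEC : NEC H
    ∼-NEC = record
      { _∼ᵥ_ = λ v w → T (does (proj₁ v ∼[ k ]? proj₁ w))
      ; _∼ₑ_ = λ e f → Corr (proj₁ e) (proj₁ f)
      ; ∼ᵥ-equiv = record
        { refl  = λ {v} → ⇒T (proj₁ v ∼[ k ]? proj₁ v) (∼-refl k)
        ; sym   = ∼T-sym
        ; trans = λ {v} {w} {x} p q → ∼T-trans (proj₁ v) (proj₁ w) (proj₁ x) p q
        }
      ; ∼ₑ-equiv = record
        { refl  = λ {e} → ⇒T (o (proj₁ e) ∼[ k ]? o (proj₁ e)) (∼-refl k) ,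
                          ⇒T (t (proj₁ e) ∼[ k ]? t (proj₁ e)) (∼-refl k) , refl
        ; sym   = Corr-sym
        ; trans = λ {e} {f} {g} (p , q , r) (p′ , q′ , r′) →
            ∼T-trans (o (proj₁ e)) (o (proj₁ f)) (o (proj₁ g)) p p′ ,
            ∼T-trans (t (proj₁ e)) (t (proj₁ f)) (t (proj₁ g)) q q′ , trans r r′
        }
      ; ∼ᵥ-prop = T-irrelevant
      ; ∼ₑ-prop = λ (p , q , r) (p′ , q′ , r′) →
          cong₂ _,_ (T-irrelevant p p′) (cong₂ _,_ (T-irrelevant q q′) (ℕ.≡-irrelevant r r′))
      ; o-compat = proj₁
      ; t-compat = proj₁ ∘ proj₂
      ; π = λ {v} {w} p → mk↔ₛ′ (transport {v} {w} p) (transport {w} {v} (∼T-sym p))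
              (transport-inverse {w} {v} (∼T-sym p) p) (transport-inverse {v} {w} p (∼T-sym p))
      ; π-spec = λ e f → mk⇔
          (λ c → proj₁ c , E-≡ (Corr-unique {proj₁ e}
             (transport-Corr {Graph.o H e} {Graph.o H f} (proj₁ c) (e , refl)) c
             (origin (transport {Graph.o H e} {Graph.o H f} (proj₁ c) (e , refl)))))
          (λ (p , eq) → subst (λ f → Corr (proj₁ e) (proj₁ f)) eq
             (transport-Corr {Graph.o H e} {Graph.o H f} p (e , refl)))
      }
      where
      ∼T-trans : ∀ v w x → T (does (v ∼[ k ]? w)) → T (does (w ∼[ k ]? x)) → T (does (v ∼[ k ]? x))
      ∼T-trans v w x p q = ⇒T (v ∼[ k ]? x) (∼-trans k (T⇒ (v ∼[ k ]? w) p) (T⇒ (w ∼[ k ]? x) q))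

    nonRedundant⇒≡ : NonRedundant H → ∀ {v w} → ¬ v ≡ R → ¬ w ≡ R → v ∼[ k ] w → v ≡ w
    nonRedundant⇒≡ nr {v} {w} v≢R w≢R v∼w = cong proj₁ (proj₁ (nr ∼-NEC)
      (v , fromWitnessFalse v≢R) (w , fromWitnessFalse w≢R) (⇒T (v ∼[ k ]? w) v∼w))

#-↭ : ∀ {A : Set} {P : A → Set} (P? : Decidable P) {xs ys} → xs ↭ ys → # P? xs ≡ # P? ys
#-↭ P? = ↭-length ∘ filter-↭ P?

#-map-cong : ∀ {A B : Set} {P : B → Set} (P? : Decidable P) (f g : A → B) xs →
             (∀ {x} → x ∈ xs → P (f x) ⇔ P (g x)) → # P? (map f xs) ≡ # P? (map g xs)
#-map-cong P? f g []       h = refl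
#-map-cong P? f g (x ∷ xs) h
  with does (P? (f x)) | does (P? (g x)) | does-⇔ (h (here refl)) (P? (f x)) (P? (g x))
... | true  | _ | refl = cong suc (#-map-cong P? f g xs (h ∘ there))
... | false | _ | refl = #-map-cong P? f g xs (h ∘ there)

isPrefix⇒length≤ : ∀ {A : Set} (_≟A_ : DecidableEquality A) xs ys →
                   isPrefix _≟A_ xs ys ≡ true → length xs ≤ length ys
isPrefix⇒length≤ _≟A_ []       ys       _  = z≤n
isPrefix⇒length≤ _≟A_ (x ∷ xs) (y ∷ ys) eq with does (x ≟A y)
... | true = s≤s (isPrefix⇒length≤ _≟A_ xs ys eq)

isPrefix-refl : ∀ {A : Set} (_≟A_ : DecidableEquality A) xs → isPrefix _≟A_ xs xs ≡ true
isPrefix-refl _≟A_ []       = refl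
isPrefix-refl _≟A_ (x ∷ xs) rewrite dec-true (x ≟A x) refl = isPrefix-refl _≟A_ xs

-- The unfolding tree and its incidence lists.

module Tree {n m} (o t : Fin m → Fin n) (R : Fin n) where

  open Refinement o t

  G 𝒯 : Graph
  G = finGraph o t
  𝒯 = Unfolding G R

  src dst : E 𝒯 → V 𝒯
  src = Graph.o 𝒯
  dst = Graph.t 𝒯

  pathLength : ∀ {v} → Path G R v → ℕ
  pathLength ε             = 0
  pathLength (p ▷ _ ⟨ _ ⟩) = suc (pathLength p)

  length-edgeList : ∀ {v} (p : Path G R v) → length (edgeList p) ≡ pathLength p
  length-edgeList ε             = refl
  length-edgeList (p ▷ e ⟨ _ ⟩) = trans (List.length-++ (edgeList p))
    (trans (ℕ.+-comm (length (edgeList p)) 1) (cong suc (length-edgeList p)))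

  depth : V 𝒯 → ℕ
  depth (_ , p) = pathLength p

  src≢dst : ∀ η → ¬ src η ≡ dst η
  src≢dst η eq = ℕ.1+n≢n (sym (cong depth eq))

  -- A list of at most one edge, so that the root needs no separate treatment in `incident`.
  parents : V 𝒯 → List (E 𝒯)
  parents (_ , ε)              = []
  parents (_ , p ▷ e ⟨ o≡w ⟩) = [ (_ , p) , e , o≡w ]

  ∈-parents⁻ : ∀ {η} x → η ∈ parents x → dst η ≡ x
  ∈-parents⁻ (_ , p ▷ e ⟨ o≡w ⟩) (here refl) = refl

  parents-unique : ∀ x → Unique (parents x)
  parents-unique (_ , ε)             = []
  parents-unique (_ , p ▷ e ⟨ o≡w ⟩) = All.[] ∷ []

  dst-injective : ∀ {η η′} → dst η ≡ dst η′ → η ≡ η′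
  dst-injective eq = List.∷-injectiveˡ (cong parents eq)

  private
    pick : ∀ v → List (Fin m) → List (OutEdges G v)
    pick v []       = []
    pick v (e ∷ es) with o e ≟ v
    ... | yes p = (e , p) ∷ pick v es
    ... | no  _ = pick v es

    map-pick : ∀ v es → map proj₁ (pick v es) ≡ filter (λ e → o e ≟ v) es
    map-pick v []       = refl
    map-pick v (e ∷ es) with o e ≟ v
    ... | yes p = cong (e ∷_) (map-pick v es)
    ... | no  _ = map-pick v es

  outEdges : ∀ v → List (OutEdges G v)
  outEdges v = pick v (allFin m)

  map-outEdges : ∀ v → map proj₁ (outEdges v) ≡ filter (λ e → o e ≟ v) (allFin m)
  map-outEdges v = map-pick v (allFin m)

  outEdges-complete : ∀ {v} (a : OutEdges G v) → a ∈ outEdges v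
  outEdges-complete {v} (e , refl)
    with (.e , refl) , e∈ , refl ← ∈-map⁻ proj₁ (subst (e ∈_) (sym (map-outEdges (o e)))
                               (∈-filter⁺ (λ e′ → o e′ ≟ o e) (∈-allFin e) refl))
    = e∈

  outEdges-unique : ∀ v → Unique (outEdges v)
  outEdges-unique v = Unique.map⁻ (subst Unique (sym (map-outEdges v))
    (Unique.filter⁺ (λ e → o e ≟ v) (Unique.allFin⁺ m)))

  map-t-outEdges : ∀ v → map (t ∘ proj₁) (outEdges v) ≡ outs v
  map-t-outEdges v = trans (List.map-∘ (outEdges v)) (cong (map t) (map-outEdges v))

  children incident : V 𝒯 → List (E 𝒯)
  children x = map (x ,_) (outEdges (proj₁ x))
  incident x = parents x ++ children x

  vertex : E 𝒯 → Fin n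
  vertex η = proj₁ (dst η)

  map-vertex-children : ∀ x → map vertex (children x) ≡ outs (proj₁ x)
  map-vertex-children x = trans (sym (List.map-∘ (outEdges (proj₁ x)))) (map-t-outEdges (proj₁ x))

  ∈-children⁻ : ∀ {η} x → η ∈ children x → src η ≡ x
  ∈-children⁻ x η∈ with _ , _ , refl ← ∈-map⁻ (x ,_) η∈ = refl

  ∈-incident⁻ : ∀ {η} x → η ∈ incident x → src η ≡ x ⊎ dst η ≡ x
  ∈-incident⁻ x η∈ = [ inj₂ ∘ ∈-parents⁻ x , inj₁ ∘ ∈-children⁻ x ]′ (∈-++⁻ (parents x) η∈)

  src-incident : ∀ η → η ∈ incident (src η)
  src-incident (x , a) = ∈-++⁺ʳ (parents x) (∈-map⁺ (x ,_) (outEdges-complete a))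

  dst-incident : ∀ η → η ∈ incident (dst η)
  dst-incident η = here refl

  incident-unique : ∀ x → Unique (incident x)
  incident-unique x = Unique.++⁺ (parents-unique x)
    (Unique.map⁺ (λ { refl → refl }) (outEdges-unique (proj₁ x)))
    (λ {η} (p , q) → src≢dst η (trans (∈-children⁻ x q) (sym (∈-parents⁻ x p))))

  -- Back p bs: bs is empty if p is the empty path, and otherwise it consists
  -- of the vertex of G whose unfolding is the tree seen from p through the
  -- edge towards the root.
  data Back : ∀ {v} → Path G R v → List (Fin n) → Set where
    root : Back ε []
    step : ∀ {w} {p : Path G R w} {bs b e} {o≡w : o e ≡ w} → Back p bs → ¬ b ≡ R →
           t e ∷ outs b ↭ bs ++ outs w → Back (p ▷ e ⟨ o≡w ⟩) [ b ]

  module _ (t≢R : ∀ e → ¬ t e ≡ R) (K : ℕ)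
           (∼⇒≡ : ∀ {v w} → ¬ v ≡ R → ¬ w ≡ R → v ∼[ K ] w → v ≡ w) where

    -- Automorphisms of the undirected unfolding tree.

    module Undirected
      (φ : V 𝒯 → V 𝒯) (ψ : E 𝒯 → E 𝒯)
      (φ-injective : ∀ {x y} → φ x ≡ φ y → x ≡ y)
      (ψ-injective : ∀ {η η′} → ψ η ≡ ψ η′ → η ≡ η′)
      (ψ-surjective : ∀ η′ → ∃ λ η → ψ η ≡ η′)
      where

      Forward Flipped : E 𝒯 → Set
      Forward η = src (ψ η) ≡ φ (src η) × dst (ψ η) ≡ φ (dst η)
      Flipped η = src (ψ η) ≡ φ (dst η) × dst (ψ η) ≡ φ (src η)

      module _ (orient : ∀ η → Forward η ⊎ Flipped η) where

        -- Incidence ignores orientation, and both lists are free of repetitions, so equality as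
        -- sets is enough.
        incident-↭ : ∀ x → map ψ (incident x) ↭ incident (φ x)
        incident-↭ x = ∼bag⇒↭ (unique∧set⇒bag
          (Unique.map⁺ ψ-injective (incident-unique x)) (incident-unique (φ x))
          (mk⇔ to from))
          where
          at-src : ∀ {η y} → src η ≡ y → η ∈ incident y
          at-src {η} refl = src-incident η

          at-dst : ∀ {η y} → dst η ≡ y → η ∈ incident y
          at-dst {η} refl = dst-incident η

          to : ∀ {η′} → η′ ∈ map ψ (incident x) → η′ ∈ incident (φ x)
          to η′∈ with η , η∈ , refl ← ∈-map⁻ ψ η′∈ with ∈-incident⁻ x η∈ | orient η
          ... | inj₁ refl | inj₁ (s , d) = at-src s
          ... | inj₁ refl | inj₂ (s , d) = at-dst d
          ... | inj₂ refl | inj₁ (s , d) = at-dst d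
          ... | inj₂ refl | inj₂ (s , d) = at-src s

          from : ∀ {η′} → η′ ∈ incident (φ x) → η′ ∈ map ψ (incident x)
          from {η′} η′∈ with η , refl ← ψ-surjective η′ = ∈-map⁺ ψ η∈
            where
            η∈ : η ∈ incident x
            η∈ with ∈-incident⁻ (φ x) η′∈ | orient η
            ... | inj₁ p | inj₁ (s , d) = at-src (φ-injective (trans (sym s) p))
            ... | inj₁ p | inj₂ (s , d) = at-dst (φ-injective (trans (sym s) p))
            ... | inj₂ p | inj₁ (s , d) = at-dst (φ-injective (trans (sym d) p))
            ... | inj₂ p | inj₂ (s , d) = at-src (φ-injective (trans (sym d) p))

        -- If `ψ η` is the parent edge of `φ x`, it heads the incidence list there. Cancelling it
        -- leaves the children of `φ x` as the images of all other edges at `x`.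
        children-↭ : ∀ {x η ηs} → η ∷ ηs ↭ incident x → dst (ψ η) ≡ φ x →
                     map (vertex ∘ ψ) ηs ↭ outs (proj₁ (φ x))
        children-↭ {x} {η} {ηs} perm d = subst₂ _↭_ (sym (List.map-∘ ηs))
          (trans (map-vertex-children (dst (ψ η))) (cong (outs ∘ proj₁) d))
          (map⁺ vertex (drop-∷ (↭-trans (map⁺ ψ perm)
            (subst (λ y → map ψ (incident x) ↭ incident y) (sym d) (incident-↭ x)))))

        -- A flipped child edge would be sent to an edge entering `φ (dst η)`, which `ψ η` enters
        -- already; in a tree these coincide.
        forward-child : ∀ {η} → Forward η → ∀ a → Forward (dst η , a)
        forward-child {η} (_ , d) a with orient (dst η , a)
        ... | inj₁ fwd     = fwd
        ... | inj₂ (_ , d′) = contradiction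
          (cong src (ψ-injective (dst-injective (trans d (sym d′))))) (src≢dst η)

        -- All edges below a forward edge are forward, so the subtree below `η` is carried onto the
        -- one below `ψ η`.
        forward-∼ : ∀ k {η} → Forward η → vertex (ψ η) ∼[ k ] vertex η
        forward-∼ zero    fwd = _
        forward-∼ (suc k) {η} fwd = forward-∼ k fwd , λ u → begin
          # (_∼[ k ]? u) (outs (vertex (ψ η)))
            ≡⟨ cong (# (_∼[ k ]? u) ∘ outs ∘ proj₁) (proj₂ fwd) ⟩
          # (_∼[ k ]? u) (outs (proj₁ (φ (dst η))))
            ≡⟨ #-↭ (_∼[ k ]? u) (children-↭ {dst η} {η} ↭-refl (proj₂ fwd)) ⟨
          # (_∼[ k ]? u) (map (vertex ∘ ψ) (children (dst η)))
            ≡⟨ #-map-cong (_∼[ k ]? u) (vertex ∘ ψ) vertex (children (dst η)) equiv ⟩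
          # (_∼[ k ]? u) (map vertex (children (dst η)))
            ≡⟨ cong (# (_∼[ k ]? u)) (map-vertex-children (dst η)) ⟩
          # (_∼[ k ]? u) (outs (vertex η)) ∎
          where
          open ≡-Reasoning
          equiv : ∀ {u η′} → η′ ∈ children (dst η) → vertex (ψ η′) ∼[ k ] u ⇔ vertex η′ ∼[ k ] u
          equiv η′∈ with a , _ , refl ← ∈-map⁻ (dst η ,_) η′∈ =
            mk⇔ (∼-trans k (∼-sym k same)) (∼-trans k same)
            where same = forward-∼ k (forward-child fwd a)

        forward-vertex : ∀ {η} → Forward η → vertex (ψ η) ≡ vertex η
        forward-vertex fwd = ∼⇒≡ (t≢R _) (t≢R _) (forward-∼ K fwd)

        -- The image of the flipped edge enters `φ x`, and only one edge does. So the parent edge of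
        -- `x` cannot be forward, and in `flipped-sibling` no other child edge can be flipped: flips
        -- spread exactly along the path to the root.
        flipped-parent : ∀ {x a η} → Flipped (x , a) → η ∈ parents x → Flipped η
        flipped-parent {x} {a} {η} (_ , d) η∈ with orient η | ∈-parents⁻ x η∈
        ... | inj₂ flip      | _    = flip
        ... | inj₁ (_ , d′) | refl = contradiction
          (cong src (ψ-injective (dst-injective (trans d′ (sym d))))) (src≢dst η)

        flipped-sibling : ∀ {x a b} → Flipped (x , a) → ¬ b ≡ a → Forward (x , b)
        flipped-sibling {x} {a} {b} (_ , d) b≢a with orient (x , b)
        ... | inj₁ fwd      = fwd
        ... | inj₂ (_ , d′) with refl ← ψ-injective (dst-injective (trans d′ (sym d))) =
          contradiction refl b≢a

        -- This is the equation required by `step`. Turned upside down, `(x , a)` becomes the parent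
        -- edge of `φ x`, whose children come from the siblings, which keep their types, and from
        -- the parent edge of `x`, which gives the backward vertex of `x`. Adding `t (proj₁ a)`
        -- restores the missing child.
        flipped-outs : ∀ {x a} → Flipped (x , a) →
                       t (proj₁ a) ∷ outs (vertex (ψ (x , a))) ↭
                       map (vertex ∘ ψ) (parents x) ++ outs (proj₁ x)
        flipped-outs {x} {a} flip@(_ , d)
          with as , bs , split ← ∈-∃++ (outEdges-complete a) = begin
          t (proj₁ a) ∷ outs (vertex (ψ (x , a)))
            ≡⟨ cong (λ y → t (proj₁ a) ∷ outs (proj₁ y)) d ⟩
          t (proj₁ a) ∷ outs (proj₁ (φ x))
            ↭⟨ prep _ (children-↭ extract d) ⟨
          t (proj₁ a) ∷ map (vertex ∘ ψ) (parents x ++ map (x ,_) (as ++ bs))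
            ≡⟨ cong (t (proj₁ a) ∷_) (List.map-++ (vertex ∘ ψ) (parents x) _) ⟩
          t (proj₁ a) ∷ map (vertex ∘ ψ) (parents x) ++ map (vertex ∘ ψ) (map (x ,_) (as ++ bs))
            ≡⟨ cong (λ vs → t (proj₁ a) ∷ map (vertex ∘ ψ) (parents x) ++ vs)
                 (trans (sym (List.map-∘ (as ++ bs))) (List.map-cong-local (All.tabulate siblings))) ⟩
          t (proj₁ a) ∷ map (vertex ∘ ψ) (parents x) ++ map (t ∘ proj₁) (as ++ bs)
            ↭⟨ shift _ (map (vertex ∘ ψ) (parents x)) _ ⟨
          map (vertex ∘ ψ) (parents x) ++ map (t ∘ proj₁) (a ∷ as ++ bs)
            ↭⟨ ++⁺ˡ (map (vertex ∘ ψ) (parents x)) (map⁺ (t ∘ proj₁) (shift a as bs)) ⟨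
          map (vertex ∘ ψ) (parents x) ++ map (t ∘ proj₁) (as ++ a ∷ bs)
            ≡⟨ cong (λ l → map (vertex ∘ ψ) (parents x) ++ map (t ∘ proj₁) l) split ⟨
          map (vertex ∘ ψ) (parents x) ++ map (t ∘ proj₁) (outEdges (proj₁ x))
            ≡⟨ cong (map (vertex ∘ ψ) (parents x) ++_) (map-t-outEdges (proj₁ x)) ⟩
          map (vertex ∘ ψ) (parents x) ++ outs (proj₁ x) ∎
          where
          open PermutationReasoning
          extract : (x , a) ∷ parents x ++ map (x ,_) (as ++ bs) ↭ incident x
          extract = ↭-trans (↭-sym (shift (x , a) (parents x) _)) (++⁺ˡ (parents x)
            (↭-trans (map⁺ (x ,_) (↭-sym (shift a as bs))) (↭-reflexive (cong (map (x ,_)) (sym split)))))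

          siblings : ∀ {b} → b ∈ as ++ bs → vertex (ψ (x , b)) ≡ t (proj₁ b)
          siblings {b} b∈ = forward-vertex (flipped-sibling flip b≢a)
            where
            b≢a : ¬ b ≡ a
            b≢a refl = Unique.Unique[x∷xs]⇒x∉xs (Permutationₛ.Unique-resp-↭ (setoid _) (↭⇒↭ₛ (shift a as bs))
              (subst Unique split (outEdges-unique (proj₁ x)))) b∈

        -- The backward vertex is the type of the image of the last edge; flippedness passes up to
        -- the root by `flipped-parent`.
        flipped⇒Back : ∀ {v} (p : Path G R v) → (∀ {η} → η ∈ parents (v , p) → Flipped η) →
                       Back p (map (vertex ∘ ψ) (parents (v , p)))
        flipped⇒Back ε             flip = root
        flipped⇒Back (p ▷ e ⟨ eq ⟩) flip =
          step (flipped⇒Back p (flipped-parent (flip (here refl)))) (t≢R _) (flipped-outs (flip (here refl)))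

    -- Cocompactness and the existence of backward vertices.

    module _ (noSinks : NoSinks G) where

      ray : ℕ → E 𝒯 → E 𝒯
      ray zero    η = η
      ray (suc i) η = dst (ray i η) , noSinks _

      depth-ray : ∀ i η → depth (dst (ray i η)) ≡ i + depth (dst η)
      depth-ray zero    η = refl
      depth-ray (suc i) η = cong suc (depth-ray i η)

      module Iso (x₀ x₁ : V 𝒯) (iso : UnfoldingAt G R _≟_ x₁ ≅ UnfoldingAt G R _≟_ x₀) where

        open _≅_ iso

        φ : V 𝒯 → V 𝒯
        φ = Inverse.to isoV

        ψ : E 𝒯 → E 𝒯
        ψ = Inverse.to isoE

        to-injective : ∀ {A B : Set} (i : A ↔ B) {x y} →
                       Inverse.to i x ≡ Inverse.to i y → x ≡ y
        to-injective i {x} {y} eq = trans (sym (Inverse.strictlyInverseʳ i x))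
          (trans (cong (Inverse.from i) eq) (Inverse.strictlyInverseʳ i y))

        open Undirected φ ψ (to-injective isoV) (to-injective isoE)
          (λ η′ → Inverse.from isoE η′ , Inverse.strictlyInverseˡ isoE η′) public

        -- An edge keeps its direction when it is reversed in both trees or in neither.
        orient : ∀ η → Forward η ⊎ Flipped η
        orient η with onRootPath G R _≟_ x₁ η | onRootPath G R _≟_ x₀ (ψ η) | o-hom η | t-hom η
        ... | true  | true  | oh | th = inj₁ (th , oh)
        ... | true  | false | oh | th = inj₂ (oh , th)
        ... | false | true  | oh | th = inj₂ (th , oh)
        ... | false | false | oh | th = inj₁ (oh , th)

        -- Each further edge of the ray is again forward, so its image descends by one level.
        forward-ray : ∀ i {η} → Forward η → Forward (ray i η) × i ≤ depth (φ (dst (ray i η)))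
        forward-ray zero    fwd = fwd , z≤n
        forward-ray (suc i) {η} fwd with fwdᵢ , i≤ ← forward-ray i fwd
          with fwd′@(s , d) ← forward-child orient fwdᵢ (noSinks _)
          = fwd′ , subst (suc i ≤_) (cong depth d) (s≤s (subst (i ≤_) (cong depth (sym s)) i≤))

        -- The last edge on the path to `x₁` is reversed there. If it is forward, its image is
        -- reversed too, hence lies on the path to `x₀`.
        forward-end : ∀ {η} → dst η ≡ x₁ → Forward η → depth (φ (dst η)) ≤ depth x₀
        forward-end {η} refl (s , d)
          with onRootPath G R _≟_ x₁ η in eq₁ | onRootPath G R _≟_ x₀ (ψ η) in eq₀ | o-hom η
        ... | false | _     | _  with () ← trans (sym eq₁) (isPrefix-refl _≟_ (edgeList (proj₂ (dst η))))
        ... | true  | false | oh = contradiction (trans oh (sym d)) (src≢dst (ψ η))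
        ... | true  | true  | _  = subst₂ _≤_
          (trans (length-edgeList (proj₂ (dst (ψ η)))) (cong depth d)) (length-edgeList (proj₂ x₀))
          (isPrefix⇒length≤ _≟_ (edgeList (proj₂ (dst (ψ η)))) (edgeList (proj₂ x₀)) eq₀)

      Back-exists : Cocompact G R _≟_ → ∀ {v} (p : Path G R v) → ¬ v ≡ R → ∃ λ b → Back p [ b ]
      Back-exists _ ε v≢R = contradiction refl v≢R
      Back-exists (k , l , iso) (p ▷ e ⟨ eq ⟩) _
        -- Among `suc k` points on the ray two share one of the `k` labels. Consecutive points are
        -- `suc d` apart, `d` being the depth of the given path: were `η₀` forward, `j * suc d`
        -- would be at most the depth `i * suc d + d` of the upper point, impossible for `i < j`.
        with i , j , i<j , same ← pigeonhole (ℕ.n<1+n k)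
               (λ i → l (dst (ray (toℕ i * suc (suc (pathLength p))) ((_ , p) , e , eq))))
        = _ , flipped⇒Back orient (p ▷ e ⟨ eq ⟩) (λ { (here refl) → flipped })
        where
        η₀ : E 𝒯
        η₀ = (_ , p) , e , eq

        d : ℕ
        d = depth (dst η₀)

        at : Fin (suc k) → E 𝒯
        at i = ray (toℕ i * suc d) η₀

        open Iso (dst (at i)) (dst (at j)) (iso _ _ (sym same))

        flipped : Flipped η₀
        flipped with orient η₀
        ... | inj₂ flip = flip
        ... | inj₁ fwd  = contradiction bound (ℕ.<⇒≱ too-deep)
          where
          bound : toℕ j * suc d ≤ toℕ i * suc d + d
          bound with fwdⱼ , j≤ ← forward-ray (toℕ j * suc d) fwd =
            ℕ.≤-trans j≤ (ℕ.≤-trans (forward-end refl fwdⱼ) (ℕ.≤-reflexive (depth-ray (toℕ i * suc d) η₀)))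

          too-deep : toℕ i * suc d + d < toℕ j * suc d
          too-deep = ℕ.≤-trans
            (ℕ.≤-reflexive (trans (sym (ℕ.+-suc (toℕ i * suc d) d)) (ℕ.+-comm (toℕ i * suc d) (suc d))))
            (ℕ.*-monoˡ-≤ (suc d) i<j)

#-∷ : ∀ {A : Set} {P : A → Set} (P? : Decidable P) x xs → # P? (x ∷ xs) ≡ indicator (does (P? x)) + # P? xs
#-∷ P? x xs with does (P? x)
... | true  = refl
... | false = refl

↭-head : ∀ {n} {x y : Fin n} {xs} → x ∷ xs ↭ y ∷ xs → x ≡ y
↭-head {x = x} {y} {xs} p with x ≟ y | trans (sym (#-∷ (_≟ y) x xs)) (trans (#-↭ (_≟ y) p) (#-∷ (_≟ y) y xs))
... | yes x≡y | _  = x≡y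
... | no  _   | eq rewrite dec-true (y ≟ y) refl = contradiction (sym eq) ℕ.1+n≢n

-- One copy of `x` is cancelled on each side; the head `y` survives on the right even when it equals
-- `x`.
∈-exchange : ∀ {A : Set} {x y : A} {xs ys} → x ∈ ys → x ∷ xs ↭ y ∷ ys → y ∈ xs
∈-exchange {x = x} {y} x∈ys p with as , bs , refl ← ∈-∃++ x∈ys =
  ∈-resp-↭ (↭-sym (drop-∷ (↭-trans p (shift x (y ∷ as) bs)))) (here refl)

-- The backward involution and the actual labelling.

module Labelling {n m} (o t : Fin m → Fin n) (R : Fin n)
  (rooted : Rooted (finGraph o t) R) (noSinks : NoSinks (finGraph o t)) (t≢R : ∀ e → ¬ t e ≡ R)
  (K : ℕ) (∼⇒≡ : ∀ {v w} → ¬ v ≡ R → ¬ w ≡ R → Refinement._∼[_]_ o t v K w → v ≡ w)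
  (back : ∀ {v} (p : Path (finGraph o t) R v) → ¬ v ≡ R → ∃ λ b → Tree.Back o t R p [ b ]) where

  open import Data.List.Sort (≤-decTotalOrder n) using (sort; sort-↭; sort-↗)
  open Refinement o t
  open Tree o t R

  outs-injective : ∀ {v w} → ¬ v ≡ R → ¬ w ≡ R → outs v ↭ outs w → v ≡ w
  outs-injective {v} {w} v≢R w≢R p = ∼⇒≡ v≢R w≢R (similar K)
    where
    similar : ∀ k → v ∼[ k ] w
    similar zero    = tt
    similar (suc k) = similar k , λ u → #-↭ (_∼[ k ]? u) p

  -- Similar heads `b` and `c` give the two right sides equal class counts at level `k`; removing
  -- `x` leaves those of `outs b′` and `outs c′`. The gain of one level drives the inductions on
  -- backward vertices.
  exchange-∼ : ∀ k {v x b b′ c c′} → x ∷ outs b′ ↭ b ∷ outs v → x ∷ outs c′ ↭ c ∷ outs v →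
               b ∼[ k ] c → b′ ∼[ suc k ] c′
  exchange-∼ k {v} {x} {b} {b′} {c} {c′} p q b∼c = coarser k b∼c , λ u →
    ℕ.+-cancelˡ-≡ (indicator (does (x ∼[ k ]? u))) _ _ (begin
      indicator (does (x ∼[ k ]? u)) + # (_∼[ k ]? u) (outs b′)  ≡⟨ exchange u p ⟩
      indicator (does (b ∼[ k ]? u)) + # (_∼[ k ]? u) (outs v)
        ≡⟨ cong (λ i → indicator i + # (_∼[ k ]? u) (outs v))
             (does-⇔ (mk⇔ (∼-trans k (∼-sym k b∼c)) (∼-trans k b∼c)) (b ∼[ k ]? u) (c ∼[ k ]? u)) ⟩
      indicator (does (c ∼[ k ]? u)) + # (_∼[ k ]? u) (outs v)   ≡⟨ exchange u q ⟨
      indicator (does (x ∼[ k ]? u)) + # (_∼[ k ]? u) (outs c′)  ∎)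
    where
    open ≡-Reasoning

    exchange : ∀ u {y z xs ys} → y ∷ xs ↭ z ∷ ys →
               indicator (does (y ∼[ k ]? u)) + # (_∼[ k ]? u) xs ≡
               indicator (does (z ∼[ k ]? u)) + # (_∼[ k ]? u) ys
    exchange u {y} {z} {xs} {ys} p =
      trans (sym (#-∷ (_∼[ k ]? u) y xs)) (trans (#-↭ (_∼[ k ]? u) p) (#-∷ (_∼[ k ]? u) z ys))

    coarser : ∀ k → b ∼[ k ] c → b′ ∼[ k ] c′
    coarser zero    _         = tt
    coarser (suc k) (b∼c , _) = exchange-∼ k p q b∼c

  -- By induction along the path the right sides agree; cancelling `t e` leaves equal out-multisets,
  -- which determine the vertex.
  Back-functional : ∀ {v} {p : Path G R v} {bs cs} → Back p bs → Back p cs → bs ≡ cs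
  Back-functional root            root             = refl
  Back-functional (step B b≢R p) (step B′ c≢R q) with refl ← Back-functional B B′ =
    cong [_] (outs-injective b≢R c≢R (drop-∷ (↭-trans p (↭-sym q))))

  Back-≢R : ∀ {v} {p : Path G R v} {b} → Back p [ b ] → ¬ b ≡ R
  Back-≢R (step _ b≢R _) = b≢R

  Back-at-R : ∀ {v} {p : Path G R v} {bs} → v ≡ R → Back p bs → bs ≡ []
  Back-at-R v≡R root         = refl
  Back-at-R v≡R (step _ _ _) = contradiction v≡R (t≢R _)

  back-edge : ∀ {v} (p : Path G R v) {b} → Back p [ b ] → ∀ e (o≡v : o e ≡ v) →
              ∃ λ b′ → Back (p ▷ e ⟨ o≡v ⟩) [ b′ ] × t e ∷ outs b′ ↭ b ∷ outs v
  back-edge p B e o≡v with b′ , B″@(step B′ _ perm) ← back (p ▷ e ⟨ o≡v ⟩) (t≢R e)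
    with refl ← Back-functional B B′ = b′ , B″ , perm

  -- Prolonging two paths to v by the same edges refines the relation between
  -- the vertices seen backwards, and outs-injective undoes the prolongation.
  Back-endpoint : ∀ {v} {p q : Path G R v} {b c} → Back p [ b ] → Back q [ c ] → b ≡ c
  Back-endpoint = go K 0 (ℕ.+-identityʳ K) tt
    where
    -- `i` levels of similarity are gained and `j` prolongations remain; at level 0 similarity is
    -- trivial.
    go : ∀ j i → j + i ≡ K → ∀ {v} {p q : Path G R v} {b c} → b ∼[ i ] c →
         Back p [ b ] → Back q [ c ] → b ≡ c
    go zero    i refl b∼c B C = ∼⇒≡ (Back-≢R B) (Back-≢R C) b∼c
    go (suc j) i j+i≡K {v} {p} {q} b∼c B C
      with e , o≡v ← noSinks v
      with b′ , B′ , permᵇ ← back-edge p B e o≡v | c′ , C′ , permᶜ ← back-edge q C e o≡v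
      with refl ← go j (suc i) (trans (ℕ.+-suc j i) j+i≡K) (exchange-∼ i permᵇ permᶜ b∼c) B′ C′
      -- With the prolonged backward vertices equal, `b` and `c` complete `outs v` to the same
      -- multiset.
      = ↭-head (↭-trans (↭-sym permᵇ) permᶜ)

  β : Fin n → Fin n
  β v with v ≟ R
  -- A filler value: the root has no backward vertex.
  ... | yes _   = R
  ... | no  v≢R = proj₁ (back (rooted v) v≢R)

  β-Back : ∀ {v} → ¬ v ≡ R → Back (rooted v) [ β v ]
  β-Back {v} v≢R with v ≟ R
  ... | yes v≡R  = contradiction v≡R v≢R
  ... | no  v≢R′ = proj₂ (back (rooted v) v≢R′)

  β-≢R : ∀ {v} → ¬ v ≡ R → ¬ β v ≡ R
  β-≢R v≢R = Back-≢R (β-Back v≢R)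

  neighbours : Fin n → List (Fin n)
  neighbours v = if does (v ≟ R) then outs v else β v ∷ outs v

  neighbours-R : neighbours R ≡ outs R
  neighbours-R rewrite dec-true (R ≟ R) refl = refl

  neighbours-≢R : ∀ {v} → ¬ v ≡ R → neighbours v ≡ β v ∷ outs v
  neighbours-≢R {v} v≢R rewrite dec-false (v ≟ R) v≢R = refl

  neighbours-Back : ∀ {v bs} → Back (rooted v) bs → bs ++ outs v ≡ neighbours v
  neighbours-Back {v} {bs} B = cases (v ≟ R)
    where
    cases : Dec (v ≡ R) → bs ++ outs v ≡ neighbours v
    cases (yes refl) = trans (cong (_++ outs R) (Back-at-R refl B)) (sym neighbours-R)
    cases (no v≢R)   = trans (cong (_++ outs v) (Back-functional B (β-Back v≢R))) (sym (neighbours-≢R v≢R))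

  -- The equation of `step` for the chosen path to `o e`, freed from the choice of path by
  -- `Back-endpoint`.
  edge-↭ : ∀ e → t e ∷ outs (β (t e)) ↭ neighbours (o e)
  edge-↭ e with b , B@(step B′ _ perm) ← back (rooted (o e) ▷ e ⟨ refl ⟩) (t≢R e) =
    subst₂ (λ u ys → t e ∷ outs u ↭ ys) (Back-endpoint B (β-Back (t≢R e))) (neighbours-Back B′) perm

  ∈-outs⁺ : ∀ e → t e ∈ outs (o e)
  ∈-outs⁺ e = ∈-map⁺ t (∈-filter⁺ (λ e′ → o e′ ≟ o e) (∈-allFin e) refl)

  ∈-outs⁻ : ∀ {u v} → u ∈ outs v → ∃ λ e → o e ≡ v × t e ≡ u
  ∈-outs⁻ {u} {v} u∈ with e , e∈ , refl ← ∈-map⁻ t u∈ =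
    e , proj₂ (∈-filter⁻ (λ e → o e ≟ v) {xs = allFin m} e∈) , refl

  edge-≢R-↭ : ∀ {e} → ¬ o e ≡ R → t e ∷ outs (β (t e)) ↭ β (o e) ∷ outs (o e)
  edge-≢R-↭ {e} o≢R = subst (t e ∷ outs (β (t e)) ↭_) (neighbours-≢R o≢R) (edge-↭ e)

  -- Thus `β` sends an edge off `R` to one in the opposite direction.
  return-edge : ∀ {e} → ¬ o e ≡ R → ∃ λ f → o f ≡ β (t e) × t f ≡ β (o e)
  return-edge {e} o≢R = ∈-outs⁻ (∈-exchange (∈-outs⁺ e) (edge-≢R-↭ o≢R))

  -- For an edge `e` leaving `v` and its return edge `f`, the equations of `f` and `e` share `β v`
  -- and `outs (β (t e))`. So similarity of `β (β (t e))` and `t e` yields that of `β (β v)` and `v`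
  -- one level higher.
  β-involutive-∼ : ∀ k {v} → ¬ v ≡ R → β (β v) ∼[ k ] v
  β-involutive-∼ zero    _ = tt
  β-involutive-∼ (suc k) {v} v≢R
    with e , refl ← noSinks v
    with f , of≡ , tf≡ ← return-edge v≢R
    = exchange-∼ k
        (subst₂ (λ w ys → w ∷ outs (β w) ↭ ys) tf≡
          (trans (cong neighbours of≡) (neighbours-≢R (β-≢R (t≢R e)))) (edge-↭ f))
        (↭-sym (edge-≢R-↭ v≢R))
        (β-involutive-∼ k (t≢R e))

  β-involutive : ∀ {v} → ¬ v ≡ R → β (β v) ≡ v
  β-involutive v≢R = ∼⇒≡ (β-≢R (β-≢R v≢R)) v≢R (β-involutive-∼ K v≢R)

  sortedNeighbours : Fin n → List (Fin n)
  sortedNeighbours = sort ∘ neighbours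

  sorted-cong : ∀ {v w} → neighbours v ↭ neighbours w → sortedNeighbours v ≡ sortedNeighbours w
  sorted-cong {v} {w} p = Pointwise-≡⇒≡ (↗↭↗⇒≋ (≤-totalOrder n)
    (sort-↗ (neighbours v)) (sort-↗ (neighbours w))
    (↭⇒↭ₛ (↭-trans (sort-↭ (neighbours v)) (↭-trans p (↭-sym (sort-↭ (neighbours w)))))))

  sorted-reflects : ∀ {v w} → sortedNeighbours v ≡ sortedNeighbours w → neighbours v ↭ neighbours w
  sorted-reflects {v} {w} eq = ↭-trans (↭-sym (sort-↭ (neighbours v)))
    (↭-trans (↭-reflexive eq) (sort-↭ (neighbours w)))

  -- A canonical representative: the search depends only on the sorted list, so vertices with equal
  -- neighbour multisets receive the same label. The default `R` never arises for the list of an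
  -- actual vertex.
  withNeighbours : List (Fin n) → Fin n
  withNeighbours xs with any? (λ w → List.≡-dec _≟_ (sortedNeighbours w) xs)
  ... | yes (w , _) = w
  ... | no  _       = R

  label : Fin n → Fin n
  label v = withNeighbours (sortedNeighbours v)

  label-cong : ∀ {v w} → neighbours v ↭ neighbours w → label v ≡ label w
  label-cong p = cong withNeighbours (sorted-cong p)

  neighbours-label : ∀ v → neighbours (label v) ↭ neighbours v
  neighbours-label v with any? (λ w → List.≡-dec _≟_ (sortedNeighbours w) (sortedNeighbours v))
  ... | yes (w , eq) = sorted-reflects eq
  ... | no  none     = contradiction (v , refl) none

  multiplicity : Fin n → Fin n → ℕ
  multiplicity x y = # (λ u → label u ≟ y) (neighbours x)

  labelCount-outs : ∀ v x → labelCount o t label v x ≡ # (λ u → label u ≟ x) (outs v)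
  labelCount-outs v x = sym (#-map-filter (λ e → o e ≟ v) (λ u → label u ≟ x) t (allFin m))

  multiplicity-label : ∀ {v} → ¬ v ≡ R → ∀ x →
    multiplicity (label v) x ≡ indicator (does (label (β v) ≟ x)) + labelCount o t label v x
  multiplicity-label {v} v≢R x = begin
    # ℓ? (neighbours (label v))                              ≡⟨ #-↭ ℓ? (neighbours-label v) ⟩
    # ℓ? (neighbours v)                                      ≡⟨ cong (# ℓ?) (neighbours-≢R v≢R) ⟩
    # ℓ? (β v ∷ outs v)                                      ≡⟨ #-∷ ℓ? (β v) (outs v) ⟩
    indicator (does (ℓ? (β v))) + # ℓ? (outs v)
      ≡⟨ cong (indicator (does (ℓ? (β v))) +_) (labelCount-outs v x) ⟨
    indicator (does (ℓ? (β v))) + labelCount o t label v x   ∎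
    where
    open ≡-Reasoning
    ℓ? : Decidable (λ u → label u ≡ x)
    ℓ? u = label u ≟ x

  δ-indicator : ∀ {k} (x y : Fin k) → δ x y ≡ indicator (does (y ≟ x))
  δ-indicator x y with x ≟ y
  ... | yes refl rewrite dec-true (x ≟ x) refl = refl
  ... | no  x≢y  rewrite dec-false (y ≟ x) (x≢y ∘ sym) = refl

  actualLabelling : ActualLabelling o t R
  actualLabelling = record
    { k = n
    ; l = label
    ; lp = label ∘ β
    ; M = multiplicity
    ; cond1 = cond1
    ; cond2 = cond2
    ; cond3 = cond3
    ; cond4 = λ x → trans (labelCount-outs R x) (trans (cong (# (λ u → label u ≟ x)) (sym neighbours-R))
                (sym (#-↭ (λ u → label u ≟ x) (neighbours-label R))))
    }
    where
    cond1 : ∀ v → ¬ v ≡ R → 1 ≤ multiplicity (label v) (label (β v))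
    cond1 v v≢R
      rewrite multiplicity-label v≢R (label (β v)) | dec-true (label (β v) ≟ label (β v)) refl = s≤s z≤n

    cond2 : ∀ v → ¬ v ≡ R → ∀ x → labelCount o t label v x ≡ multiplicity (label v) x ∸ δ x (label (β v))
    cond2 v v≢R x = sym (trans (cong₂ _∸_ (multiplicity-label v≢R x) (δ-indicator x (label (β v))))
      (ℕ.m+n∸m≡n (indicator (does (label (β v) ≟ x))) _))

    cond3 : ∀ v → ¬ v ≡ R → ∀ e → t e ≡ v → label (o e) ≡ label (β v)
    -- As `β` is an involution, the left side of `edge-↭ e` is `neighbours (β (t e))`.
    cond3 .(t e) v≢R e refl = label-cong (↭-trans (↭-sym (edge-↭ e))
      (↭-reflexive (sym (trans (neighbours-≢R (β-≢R v≢R)) (cong (_∷ outs (β (t e))) (β-involutive v≢R))))))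

theorem1p1 : ∀ {n m} (o t : Fin m → Fin n) (R : Fin n) →
    Rooted (finGraph o t) R →
    NoSinks (finGraph o t) →
    (∀ e → ¬ t e ≡ R) →
    2 < outDegree o R →
    StronglyConnected (finGraph o t ∖[ R , _≟_ ]) →
    NonRedundant (finGraph o t ∖[ R , _≟_ ]) →
    Cocompact (finGraph o t) R _≟_ →
    ActualLabelling o t R
theorem1p1 o t R rooted noSinks t≢R _ _ nonRedundant cocompact =
  Labelling.actualLabelling o t R rooted noSinks t≢R K ∼⇒≡
    (Tree.Back-exists o t R t≢R K ∼⇒≡ noSinks cocompact)
  where
  open Refinement o t

  K : ℕ
  K = proj₁ ∼-stabilises

  ∼⇒≡ : ∀ {v w} → ¬ v ≡ R → ¬ w ≡ R → v ∼[ K ] w → v ≡ w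
  ∼⇒≡ = nonRedundant⇒≡ K (proj₂ ∼-stabilises) R t≢R nonRedundant
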